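{- Let $G$ be a connected graph with $n\geq 6$ vertices that has at least one basis forced vertex. Then $|E(G)|\leq \frac{n(n-1)}{2}-4$. Moreover, if $|E(G)|=\frac{n(n-1)}{2}-4$, then the complement $\overline{G}$ is isomorphic to the disjoint union of the path $P_5$ (on 5 vertices) and $n-5$ isolated vertices, and $G$ has exactly two basis forced vertices.
   Context: All graphs are finite and simple. For vertices $u,v$ of a connected graph $G$, $d(u,v)$ is the length of a shortest $u$–$v$ path. A set $R\subseteq V(G)$ is a resolving set if for all distinct $x,y\in V(G)$ there is $r\in R$ with $d(r,x)\neq d(r,y)$. The metric dimension $\dim(G)$ is the minimum cardinality of a resolving set, and a resolving set of cardinality $\dim(G)$ is a metric basis. A vertex is a basis forced vertex if it belongs to every metric basis of $G$. $\overline{G}$ denotes the complement graph of $G$. -}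

module Defs where

open import Level using (0ℓ)
open import Data.Empty using (⊥)
open import Data.Nat using (ℕ; zero; suc; _+_; _≤_)
import Data.Nat.Properties as ℕ
open import Data.Fin using (Fin; toℕ; splitAt)
open import Data.Fin.Properties using (_≟_; _<?_)
open import Data.Fin.Subset using (Subset; _∈_; ∣_∣)
open import Data.List using (List; []; _∷_; length; filter; allFin; cartesianProduct)
open import Data.List.Relation.Unary.Unique.Propositional using (Unique)
open import Data.Product using (Σ; _×_; _,_; ∃; ∃₂)
open import Data.Sum using (_⊎_; inj₁; inj₂; swap)
open import Function using (_∘_; _↔_; _⇔_; Inverse)
open import Relation.Binary using (Rel; Decidable; Symmetric; Irreflexive)
open import Relation.Binary.PropositionalEquality using (_≡_; _≢_; refl; sym)
open import Relation.Nullary using (¬_; no)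
open import Relation.Nullary.Decidable using (_×-dec_; _⊎-dec_; ¬?)

-- Finite simple graphs with vertex set Fin n.
record Graph (n : ℕ) : Set₁ where
  field
    Adj        : Rel (Fin n) 0ℓ
    adj?       : Decidable Adj
    adj-sym    : Symmetric Adj
    adj-irrefl : Irreflexive _≡_ Adj

open Graph public

private
  variable
    m n : ℕ

-- Each edge {i, j} is counted once, as the pair (i , j) with i < j.
edges : Graph n → List (Fin n × Fin n)
edges {n} G = filter (λ (i , j) → (i <? j) ×-dec adj? G i j)
                     (cartesianProduct (allFin n) (allFin n))

numEdges : Graph n → ℕ
numEdges = length ∘ edges

complement : Graph n → Graph n
complement G = record
  { Adj        = λ u v → u ≢ v × ¬ Adj G u v
  ; adj?       = λ u v → ¬? (u ≟ v) ×-dec ¬? (adj? G u v)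
  ; adj-sym    = λ (u≢v , ¬uv) → u≢v ∘ sym , ¬uv ∘ adj-sym G
  ; adj-irrefl = λ u≡v (u≢v , _) → u≢v u≡v
  }

edgeless : (n : ℕ) → Graph n
edgeless n = record
  { Adj        = λ _ _ → ⊥
  ; adj?       = λ _ _ → no (λ ())
  ; adj-sym    = λ ()
  ; adj-irrefl = λ _ ()
  }

-- The path P_n on n vertices 0 – 1 – ⋯ – (n − 1).
pathGraph : (n : ℕ) → Graph n
pathGraph n = record
  { Adj        = λ u v → suc (toℕ u) ≡ toℕ v ⊎ suc (toℕ v) ≡ toℕ u
  ; adj?       = λ u v → (suc (toℕ u) ℕ.≟ toℕ v) ⊎-dec (suc (toℕ v) ℕ.≟ toℕ u)
  ; adj-sym    = swap
  ; adj-irrefl = λ { refl (inj₁ e) → ℕ.1+n≢n e ; refl (inj₂ e) → ℕ.1+n≢n e }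
  }

-- Disjoint union: Fin (m + n) is split as Fin m ⊎ Fin n.
module _ (G : Graph m) (H : Graph n) where

  SumAdj : Rel (Fin m ⊎ Fin n) 0ℓ
  SumAdj (inj₁ u) (inj₁ v) = Adj G u v
  SumAdj (inj₂ u) (inj₂ v) = Adj H u v
  SumAdj (inj₁ _) (inj₂ _) = ⊥
  SumAdj (inj₂ _) (inj₁ _) = ⊥

  sumAdj? : Decidable SumAdj
  sumAdj? (inj₁ u) (inj₁ v) = adj? G u v
  sumAdj? (inj₂ u) (inj₂ v) = adj? H u v
  sumAdj? (inj₁ _) (inj₂ _) = no (λ ())
  sumAdj? (inj₂ _) (inj₁ _) = no (λ ())

  sumAdj-sym : Symmetric SumAdj
  sumAdj-sym {inj₁ _} {inj₁ _} = adj-sym G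
  sumAdj-sym {inj₂ _} {inj₂ _} = adj-sym H
  sumAdj-sym {inj₁ _} {inj₂ _} ()
  sumAdj-sym {inj₂ _} {inj₁ _} ()

  sumAdj-irrefl : Irreflexive _≡_ SumAdj
  sumAdj-irrefl {inj₁ _} refl = adj-irrefl G refl
  sumAdj-irrefl {inj₂ _} refl = adj-irrefl H refl

  disjointUnion : Graph (m + n)
  disjointUnion = record
    { Adj        = λ u v → SumAdj (splitAt m u) (splitAt m v)
    ; adj?       = λ u v → sumAdj? (splitAt m u) (splitAt m v)
    ; adj-sym    = λ {u} {v} → sumAdj-sym {splitAt m u} {splitAt m v}
    ; adj-irrefl = λ { {u} refl → sumAdj-irrefl {splitAt m u} refl }
    }

Isomorphic : Graph m → Graph n → Set
Isomorphic {m} {n} G H =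
  Σ (Fin m ↔ Fin n) λ f →
    ∀ u v → Adj G u v ⇔ Adj H (Inverse.to f u) (Inverse.to f v)

module _ (G : Graph n) where

  data Walk : Fin n → Fin n → ℕ → Set where
    done : ∀ {u} → Walk u u zero
    step : ∀ {u v w k} → Adj G u v → Walk v w k → Walk u w (suc k)

  vertices : ∀ {u v k} → Walk u v k → List (Fin n)
  vertices {u} done       = u ∷ []
  vertices {u} (step _ w) = u ∷ vertices w

  Path : Fin n → Fin n → ℕ → Set
  Path u v k = Σ (Walk u v k) (Unique ∘ vertices)

  Connected : Set
  Connected = ∀ u v → ∃ (Path u v)

  -- d(u, v) = k.
  IsDistance : Fin n → Fin n → ℕ → Set
  IsDistance u v k = Path u v k × (∀ l → Path u v l → k ≤ l)

  -- d(r, x) ≠ d(r, y).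
  Resolves : Fin n → Fin n → Fin n → Set
  Resolves r x y = ∃₂ λ k l → IsDistance r x k × IsDistance r y l × k ≢ l

  IsResolving : Subset n → Set
  IsResolving R = ∀ x y → x ≢ y → ∃ λ r → r ∈ R × Resolves r x y

  -- dim(G) = k.
  IsMetricDimension : ℕ → Set
  IsMetricDimension k =
    (∃ λ R → IsResolving R × ∣ R ∣ ≡ k) × (∀ R → IsResolving R → k ≤ ∣ R ∣)

  IsMetricBasis : Subset n → Set
  IsMetricBasis R = IsResolving R × IsMetricDimension ∣ R ∣

  BasisForced : Fin n → Set
  BasisForced v = ∀ R → IsMetricBasis R → v ∈ R

{-# OPTIONS --safe #-}
module Submission where

-- Let H be the complement of G. If H has at most four edges and n ≥ 6, then G has diameter at
-- most 2, so R resolves G if and only if any two vertices outside R are separated by the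
-- H-neighbourhood of some r ∈ R ("R is locating in H"). Write H as a graph P without isolated
-- vertices plus t isolated vertices. These are twins, so a locating set contains all of them
-- except at most one; if one is missing, the part in P must also be dominating. Hence for t ≥ 1
-- the minimum locating sets of H with one isolated vertex missing are given by the minimum
-- locating-dominating sets of P, and for t = 0 by the minimum locating sets of P. As P has at
-- most four edges, only finitely many P occur; evaluation shows that, apart from P₅, every
-- vertex of P is avoided by one of these minimum sets, while for P₅ the unique minimum
-- locating-dominating set consists of the second and the fourth vertex.

open import Defs
open import Data.Bool using (Bool; true; false; T; if_then_else_; not; _∧_; _∨_)
open import Data.Bool.Properties using (T-∧; T-≡)
open import Data.Fin using (Fin; zero; suc; toℕ; splitAt; join; _↑ˡ_; _↑ʳ_; _<_)
open import Data.Fin.Permutation using (↔⇒≡)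
open import Data.Fin.Properties using (_≟_; _<?_; all?; any?; <-cmp; splitAt-↑ˡ; splitAt-↑ʳ; splitAt-join; join-splitAt; ↑ˡ-injective; ↑ʳ-injective; +↔⊎)
open import Data.Fin.Subset using (Subset; _∈_; _∉_; _⊆_; ∣_∣; inside; outside; ∁; ⁅_⁆; ⊤; ⊥)
open import Data.Fin.Subset.Properties using (_∈?_; anySubset?; p⊆q⇒∣p∣≤∣q∣; ∣p∣≤n; ∣∁p∣≡n∸∣p∣; ∣⁅x⁆∣≡1; ∣⊤∣≡n; ∣⊥∣≡0; x∈⁅x⁆; x∈⁅y⁆⇒x≡y; x∈p⇒x∉∁p; x∉∁p⇒x∈p; x∈∁p⇒x∉p; ∉⊥)
open import Data.List as List using (List; []; _∷_; length; filter; allFin; cartesianProduct)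
import Data.List.Membership.Propositional as Membership
open import Data.List.Membership.Propositional.Properties using (∈-allFin; ∈-filter⁺; ∈-filter⁻; ∈-lookup; ∈-cartesianProduct⁺)
open import Data.List.Properties using (length-++; filter-++; length-tabulate; map-tabulate)
open import Data.List.Relation.Binary.Pointwise using (Pointwise; []; _∷_)
open import Data.List.Relation.Unary.All as All using (All; []; _∷_)
open import Data.List.Relation.Unary.AllPairs using ([]; _∷_)
open import Data.List.Relation.Unary.Any as Any using (Any; here; there)
open import Data.List.Relation.Unary.Any.Properties using (lookup-index)
open import Data.List.Relation.Unary.Unique.Propositional using (Unique)
import Data.List.Relation.Unary.Unique.Propositional.Properties as Unique
open import Data.Nat using (ℕ; zero; suc; pred; _+_; _*_; _∸_; _≤_; _/_; z≤n; s≤s; >-nonZero)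
open import Data.Nat.DivMod using (m*n/n≡m)
import Data.Nat.Properties as ℕ
open import Data.Product using (∃; _×_; _,_; proj₁; proj₂)
open import Data.Sum using (_⊎_; inj₁; inj₂; [_,_]′)
open import Data.Vec as Vec using ([]; _∷_; _++_; lookup; tabulate)
import Data.Vec.Functional as Functional
open import Data.Vec.Properties using (lookup⇒[]=; []=⇒lookup; lookup∘tabulate; lookup-++ˡ; lookup-++ʳ)
open import Function using (_∘_; _⇔_; _↔_; Equivalence; Inverse; Injective; mk⇔; mk↔ₛ′)
open import Function.Construct.Symmetry using (↔-sym)
open import Function.Properties.Inverse using (↔-trans)
open import Level using (0ℓ)
open import Relation.Binary using (tri<; tri≈; tri>)
open import Relation.Binary.PropositionalEquality using (_≡_; _≢_; refl; sym; trans; cong; cong₂; subst; subst₂; module ≡-Reasoning)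
open import Relation.Nullary using (¬_; Dec; yes; no; does; contradiction)
open import Relation.Nullary.Decidable using (¬?; map′; _×-dec_; _⊎-dec_; _→-dec_; decidable-stable; from-yes; toWitness; ⌊_⌋)
open import Relation.Unary using (Pred; Decidable)
open import Algebra.Properties.CommutativeMonoid.Sum ℕ.+-0-commutativeMonoid using (sum; sum-cong-≗; sum-permute)

open Equivalence using () renaming (to to ⇒; from to ⇐)

private
  variable
    k m n t w : ℕ

-- Locating and locating-dominating sets

module _ (H : Graph n) where

  Separates : Fin n → Fin n → Fin n → Set
  Separates r x y = (Adj H r x × ¬ Adj H r y) ⊎ (¬ Adj H r x × Adj H r y)

  Locating : Subset n → Set
  Locating R = ∀ x → x ∉ R → ∀ y → y ∉ R → x ≢ y → ∃ λ r → r ∈ R × Separates r x y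

  Dominating : Subset n → Set
  Dominating R = ∀ x → x ∉ R → ∃ λ r → r ∈ R × Adj H r x

  LocDom : Subset n → Set
  LocDom R = Dominating R × Locating R

  MinLocating : Subset n → Set
  MinLocating R = Locating R × (∀ R′ → Locating R′ → ∣ R ∣ ≤ ∣ R′ ∣)

  Forced : Fin n → Set
  Forced v = ∀ R → MinLocating R → v ∈ R

  -- For the complement of G, this says that G has diameter at most 2.
  EdgesAvoidable : Set
  EdgesAvoidable = ∀ u v → Adj H u v → ∃ λ z → z ≢ u × z ≢ v × ¬ Adj H z u × ¬ Adj H z v

  separates? : ∀ r x y → Dec (Separates r x y)
  separates? r x y =
    (adj? H r x ×-dec ¬? (adj? H r y)) ⊎-dec (¬? (adj? H r x) ×-dec adj? H r y)

  locating? : ∀ R → Dec (Locating R)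
  locating? R = all? λ x → ¬? (x ∈? R) →-dec all? λ y → ¬? (y ∈? R) →-dec
    (¬? (x ≟ y) →-dec any? λ r → (r ∈? R) ×-dec separates? r x y)

  locDom? : ∀ R → Dec (LocDom R)
  locDom? R =
    (all? λ x → ¬? (x ∈? R) →-dec any? λ r → (r ∈? R) ×-dec adj? H r x) ×-dec locating? R

  edgesAvoidable? : Dec EdgesAvoidable
  edgesAvoidable? = all? λ u → all? λ v → adj? H u v →-dec any? λ z →
    ¬? (z ≟ u) ×-dec ¬? (z ≟ v) ×-dec ¬? (adj? H z u) ×-dec ¬? (adj? H z v)

-- Graphs of diameter at most 2

module _ (G : Graph n) (avoid : EdgesAvoidable (complement G)) where

  private
    H = complement G

    nonAdj⇒adj : ∀ {u v} → u ≢ v → ¬ Adj H u v → Adj G u v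
    nonAdj⇒adj u≢v ¬uv = decidable-stable (adj? G _ _) λ ¬g → ¬uv (u≢v , ¬g)

  -- A non-edge of `G` is an edge of `H`, and a vertex that avoids this edge is adjacent in `G` to
  -- both of its ends.
  commonNeighbour : ∀ {u v} → u ≢ v → ¬ Adj G u v → ∃ λ z → Adj G u z × Adj G z v
  commonNeighbour {u} {v} u≢v ¬uv with avoid u v (u≢v , ¬uv)
  ... | z , z≢u , z≢v , ¬zu , ¬zv = z , adj-sym G (nonAdj⇒adj z≢u ¬zu) , nonAdj⇒adj z≢v ¬zv

  dist : Fin n → Fin n → ℕ
  dist r x with r ≟ x
  ... | yes _ = 0
  ... | no _ with adj? G r x
  ...   | yes _ = 1
  ...   | no _  = 2

  dist-isDistance : ∀ r x → IsDistance G r x (dist r x)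
  dist-isDistance r x with r ≟ x
  ... | yes refl = (done , [] ∷ []) , λ _ _ → z≤n
  ... | no r≢x with adj? G r x
  ...   | yes rx = (step rx done , (r≢x ∷ []) ∷ [] ∷ []) , minimal
    where
    minimal : ∀ l → Path G r x l → 1 ≤ l
    minimal zero    (done , _) = contradiction refl r≢x
    minimal (suc l) _          = s≤s z≤n
  ...   | no ¬rx with commonNeighbour r≢x ¬rx
  ...     | z , rz , zx =
    ( step rz (step zx done)
    , ((λ r≡z → adj-irrefl G r≡z rz) ∷ r≢x ∷ []) ∷ ((λ z≡x → adj-irrefl G z≡x zx) ∷ []) ∷ [] ∷ [])
    , minimal
    where
    minimal : ∀ l → Path G r x l → 2 ≤ l
    minimal zero          (done , _)         = contradiction refl r≢x
    minimal (suc zero)    (step rx done , _) = contradiction rx ¬rx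
    minimal (suc (suc l)) _                  = s≤s (s≤s z≤n)

  distance-unique : ∀ {r x k l} → IsDistance G r x k → IsDistance G r x l → k ≡ l
  distance-unique (p , p-min) (q , q-min) = ℕ.≤-antisym (p-min _ q) (q-min _ p)

  dist-self : ∀ r → dist r r ≡ 0
  dist-self r = distance-unique (dist-isDistance r r) ((done , [] ∷ []) , λ _ _ → z≤n)

  dist≡0 : ∀ {r x} → dist r x ≡ 0 → r ≡ x
  dist≡0 {r} {x} d≡0 with subst (Path G r x) d≡0 (proj₁ (dist-isDistance r x))
  ... | done , _ = refl

  dist-adj : ∀ {r x} → r ≢ x → Adj G r x → dist r x ≡ 1
  dist-adj {r} {x} r≢x rx with r ≟ x
  ... | yes r≡x = contradiction r≡x r≢x
  ... | no _ with adj? G r x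
  ...   | yes _  = refl
  ...   | no ¬rx = contradiction rx ¬rx

  dist-nonAdj : ∀ {r x} → r ≢ x → ¬ Adj G r x → dist r x ≡ 2
  dist-nonAdj {r} {x} r≢x ¬rx with r ≟ x
  ... | yes r≡x = contradiction r≡x r≢x
  ... | no _ with adj? G r x
  ...   | yes rx = contradiction rx ¬rx
  ...   | no _   = refl

  dist≢⇒resolves : ∀ {r x y} → dist r x ≢ dist r y → Resolves G r x y
  dist≢⇒resolves {r} {x} {y} d≢ = _ , _ , dist-isDistance r x , dist-isDistance r y , d≢

  resolves⇒dist≢ : ∀ {r x y} → Resolves G r x y → dist r x ≢ dist r y
  resolves⇒dist≢ {r} {x} {y} (_ , _ , p , q , k≢l) d≡ = k≢l
    (trans (distance-unique p (dist-isDistance r x)) (trans d≡ (distance-unique (dist-isDistance r y) q)))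

  -- A vertex `r` of `R` differs from `x` and `y`, which lie outside `R`. So both distances are 1 or
  -- 2, and they differ exactly if `r` is adjacent to one of `x`, `y` only.
  resolving⇒locating : ∀ {R} → IsResolving G R → Locating H R
  resolving⇒locating {R} res x x∉R y y∉R x≢y with res x y x≢y
  ... | r , r∈R , resolves = r , r∈R , separates
    where
    r≢ : ∀ {z} → z ∉ R → r ≢ z
    r≢ z∉R refl = z∉R r∈R
    d≢ = resolves⇒dist≢ resolves
    separates : Separates H r x y
    separates with adj? G r x | adj? G r y
    ... | yes rx | yes ry = contradiction (trans (dist-adj (r≢ x∉R) rx) (sym (dist-adj (r≢ y∉R) ry))) d≢
    -- Adjacency in `G` is non-adjacency in `H`, hence the sides are exchanged.
    ... | yes rx | no ¬ry = inj₂ ((λ (_ , ¬rx) → ¬rx rx) , r≢ y∉R , ¬ry)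
    ... | no ¬rx | yes ry = inj₁ ((r≢ x∉R , ¬rx) , λ (_ , ¬ry) → ¬ry ry)
    ... | no ¬rx | no ¬ry = contradiction (trans (dist-nonAdj (r≢ x∉R) ¬rx) (sym (dist-nonAdj (r≢ y∉R) ¬ry))) d≢

  -- A vertex of the pair that lies in `R` resolves the pair itself, being the only vertex at
  -- distance 0 from itself. Pairs outside `R` are left to the locating property.
  locating⇒resolving : ∀ {R} → Locating H R → IsResolving G R
  locating⇒resolving {R} loc x y x≢y with x ∈? R | y ∈? R
  ... | yes x∈R | _       = x , x∈R , dist≢⇒resolves λ d≡ → x≢y (dist≡0 (trans (sym d≡) (dist-self x)))
  ... | no _    | yes y∈R = y , y∈R , dist≢⇒resolves λ d≡ → x≢y (sym (dist≡0 (trans d≡ (dist-self y))))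
  ... | no x∉R  | no y∉R with loc x x∉R y y∉R x≢y
  ...   | r , r∈R , sep = r , r∈R , dist≢⇒resolves (d≢ sep)
    where
    r≢ : ∀ {z} → z ∉ R → r ≢ z
    r≢ z∉R refl = z∉R r∈R
    d≢ : Separates H r x y → dist r x ≢ dist r y
    d≢ (inj₁ ((_ , ¬rx) , ¬ry)) d≡ = contradiction
      (trans (sym (dist-nonAdj (r≢ x∉R) ¬rx)) (trans d≡ (dist-adj (r≢ y∉R) (nonAdj⇒adj (r≢ y∉R) ¬ry)))) λ ()
    d≢ (inj₂ (¬rx , (_ , ¬ry))) d≡ = contradiction
      (trans (sym (dist-adj (r≢ x∉R) (nonAdj⇒adj (r≢ x∉R) ¬rx))) (trans d≡ (dist-nonAdj (r≢ y∉R) ¬ry))) λ ()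

  basisForced⇔forced : ∀ v → BasisForced G v ⇔ Forced H v
  basisForced⇔forced v = mk⇔
    (λ forced R (loc , min) → forced R
      ( locating⇒resolving loc
      , (R , locating⇒resolving loc , refl)
      , λ R′ res → min R′ (resolving⇒locating res)))
    (λ forced R (res , _ , min) → forced R
      (resolving⇒locating res , λ R′ loc → min R′ (locating⇒resolving loc)))

-- Invariance under isomorphism

image : Fin m ↔ Fin n → Subset m → Subset n
image f R = tabulate (lookup R ∘ Inverse.from f)

module _ (f : Fin m ↔ Fin n) {R : Subset m} where

  ∈-image⁺ : ∀ {y} → Inverse.from f y ∈ R → y ∈ image f R
  ∈-image⁺ {y} y∈ = lookup⇒[]= y _ (trans (lookup∘tabulate _ y) ([]=⇒lookup y∈))

  ∈-image⁻ : ∀ {y} → y ∈ image f R → Inverse.from f y ∈ R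
  ∈-image⁻ {y} y∈ = lookup⇒[]= _ R (trans (sym (lookup∘tabulate _ y)) ([]=⇒lookup y∈))

  to∈image : ∀ {x} → x ∈ R → Inverse.to f x ∈ image f R
  to∈image {x} x∈R = ∈-image⁺ (subst (_∈ R) (sym (Inverse.strictlyInverseʳ f x)) x∈R)

indicator : Bool → ℕ
indicator b = if b then 1 else 0

∣p∣≡sum : (p : Subset n) → ∣ p ∣ ≡ sum (indicator ∘ lookup p)
∣p∣≡sum []          = refl
∣p∣≡sum (true ∷ p)  = cong suc (∣p∣≡sum p)
∣p∣≡sum (false ∷ p) = ∣p∣≡sum p

-- The cardinality is the sum of the indicator values, and a bijection only permutes the summands.
∣image∣ : (f : Fin m ↔ Fin n) (R : Subset m) → ∣ image f R ∣ ≡ ∣ R ∣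
∣image∣ f R = begin
  ∣ image f R ∣                                  ≡⟨ ∣p∣≡sum (image f R) ⟩
  sum (indicator ∘ lookup (image f R))           ≡⟨ sum-cong-≗ {_} {indicator ∘ lookup (image f R)}
                                                      (cong indicator ∘ lookup∘tabulate _) ⟩
  sum (indicator ∘ lookup R ∘ Inverse.from f)    ≡⟨ sum-permute (indicator ∘ lookup R) (↔-sym f) ⟨
  sum (indicator ∘ lookup R)                     ≡⟨ ∣p∣≡sum R ⟨
  ∣ R ∣                                          ∎
  where open ≡-Reasoning

isomorphic-sym : (G : Graph m) (H : Graph n) → Isomorphic G H → Isomorphic H G
isomorphic-sym G H (f , f-adj) = ↔-sym f , λ u v → mk⇔
  (⇐ (f-adj _ _) ∘ subst₂ (Adj H) (sym (Inverse.strictlyInverseˡ f u)) (sym (Inverse.strictlyInverseˡ f v)))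
  (subst₂ (Adj H) (Inverse.strictlyInverseˡ f u) (Inverse.strictlyInverseˡ f v) ∘ ⇒ (f-adj _ _))

module _ (G : Graph m) (H : Graph n) where

  edgesAvoidable-iso : Isomorphic G H → EdgesAvoidable H → EdgesAvoidable G
  edgesAvoidable-iso (f , f-adj) avoid u v uv with avoid _ _ (⇒ (f-adj u v) uv)
  ... | z , z≢u , z≢v , ¬zu , ¬zv =
    from z , z≢u ∘ to-from , z≢v ∘ to-from
    , ¬zu ∘ subst (λ y → Adj H y (to u)) (strictlyInverseˡ z) ∘ ⇒ (f-adj _ u)
    , ¬zv ∘ subst (λ y → Adj H y (to v)) (strictlyInverseˡ z) ∘ ⇒ (f-adj _ v)
    where
    open Inverse f
    to-from : ∀ {x} → from z ≡ x → z ≡ to x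
    to-from refl = sym (strictlyInverseˡ z)

  locating-image : (iso : Isomorphic G H) → ∀ {R} → Locating G R → Locating H (image (proj₁ iso) R)
  locating-image iso@(f , f-adj) {R} loc x x∉ y y∉ x≢y
    with loc (from x) (x∉ ∘ ∈-image⁺ f) (from y) (y∉ ∘ ∈-image⁺ f) (x≢y ∘ from-injective)
    where
    open Inverse f
    from-injective : from x ≡ from y → x ≡ y
    from-injective e = trans (sym (strictlyInverseˡ x)) (trans (cong to e) (strictlyInverseˡ y))
  ... | r , r∈R , sep = Inverse.to f r , to∈image f r∈R , separates sep
    where
    open Inverse f
    adj⇔ : ∀ z → Adj G r (from z) ⇔ Adj H (to r) z
    adj⇔ z = subst (λ y → Adj G r (from z) ⇔ Adj H (to r) y) (strictlyInverseˡ z) (f-adj r (from z))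
    separates : Separates G r (from x) (from y) → Separates H (to r) x y
    separates (inj₁ (rx , ¬ry)) = inj₁ (⇒ (adj⇔ x) rx , ¬ry ∘ ⇐ (adj⇔ y))
    separates (inj₂ (¬rx , ry)) = inj₂ (¬rx ∘ ⇐ (adj⇔ x) , ⇒ (adj⇔ y) ry)

module _ (G : Graph m) (H : Graph n) where

  minLocating-image : (iso : Isomorphic G H) → ∀ {R} → MinLocating G R → MinLocating H (image (proj₁ iso) R)
  minLocating-image iso@(f , _) {R} (loc , min) = locating-image G H iso loc , λ R′ loc′ →
    subst₂ _≤_ (sym (∣image∣ f R)) (∣image∣ (↔-sym f) R′)
      (min (image (↔-sym f) R′) (locating-image H G (isomorphic-sym G H iso) loc′))

module _ (G : Graph m) (H : Graph n) (iso : Isomorphic G H) where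

  private
    f = proj₁ iso
    open Inverse f

  -- In each direction an arbitrary minimum locating set is transported to the other graph, where
  -- the hypothesis applies to it.
  forced-iso : ∀ v → Forced G v ⇔ Forced H (to v)
  forced-iso v = mk⇔
    (λ forced R min → ∈-image⁻ (↔-sym f) (forced _ (minLocating-image H G (isomorphic-sym G H iso) min)))
    (λ forced R min → subst (_∈ R) (strictlyInverseʳ v) (∈-image⁻ f (forced _ (minLocating-image G H iso min))))

-- Adding isolated vertices

module _ {S : Subset w} {Q : Subset t} where

  ∈-++⁺ˡ : ∀ {i} → i ∈ S → i ↑ˡ t ∈ S ++ Q
  ∈-++⁺ˡ {i} i∈S = lookup⇒[]= _ _ (trans (lookup-++ˡ S Q i) ([]=⇒lookup i∈S))

  ∈-++⁻ˡ : ∀ {i} → i ↑ˡ t ∈ S ++ Q → i ∈ S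
  ∈-++⁻ˡ {i} i∈ = lookup⇒[]= _ _ (trans (sym (lookup-++ˡ S Q i)) ([]=⇒lookup i∈))

  ∈-++⁺ʳ : ∀ {j} → j ∈ Q → w ↑ʳ j ∈ S ++ Q
  ∈-++⁺ʳ {j} j∈Q = lookup⇒[]= _ _ (trans (lookup-++ʳ S Q j) ([]=⇒lookup j∈Q))

  ∈-++⁻ʳ : ∀ {j} → w ↑ʳ j ∈ S ++ Q → j ∈ Q
  ∈-++⁻ʳ {j} j∈ = lookup⇒[]= _ _ (trans (sym (lookup-++ʳ S Q j)) ([]=⇒lookup j∈))

∣++∣ : (S : Subset w) (Q : Subset t) → ∣ S ++ Q ∣ ≡ ∣ S ∣ + ∣ Q ∣
∣++∣ []            Q = refl
∣++∣ (inside ∷ S)  Q = cong suc (∣++∣ S Q)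
∣++∣ (outside ∷ S) Q = ∣++∣ S Q

-- A view: matching on it replaces a vertex of the disjoint union by its injection from one of the
-- summands.
data Summand (w t : ℕ) : Fin (w + t) → Set where
  left  : ∀ i → Summand w t (i ↑ˡ t)
  right : ∀ j → Summand w t (w ↑ʳ j)

summand : ∀ w t x → Summand w t x
summand w t x = subst (Summand w t) (join-splitAt w t x) (view (splitAt w x))
  where
  view : ∀ s → Summand w t (join w t s)
  view (inj₁ i) = left i
  view (inj₂ j) = right j

infixl 6 _⊕_

_⊕_ : Graph w → (t : ℕ) → Graph (w + t)
P ⊕ t = disjointUnion P (edgeless t)

module _ (P : Graph w) {t : ℕ} where

  adj-⊕ : ∀ {i j} → Adj P i j ⇔ Adj (P ⊕ t) (i ↑ˡ t) (j ↑ˡ t)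
  adj-⊕ {i} {j} rewrite splitAt-↑ˡ w i t | splitAt-↑ˡ w j t = mk⇔ (λ p → p) (λ p → p)

  isolated : ∀ {x j} → ¬ Adj (P ⊕ t) x (w ↑ʳ j)
  isolated {x} {j} rewrite splitAt-↑ʳ w t j with splitAt w x
  ... | inj₁ _ = λ ()
  ... | inj₂ _ = λ ()

  separates-⊕⁻ : ∀ {r i j} → Separates (P ⊕ t) (r ↑ˡ t) (i ↑ˡ t) (j ↑ˡ t) → Separates P r i j
  separates-⊕⁻ (inj₁ (ri , ¬rj)) = inj₁ (⇐ adj-⊕ ri , ¬rj ∘ ⇒ adj-⊕)
  separates-⊕⁻ (inj₂ (¬ri , rj)) = inj₂ (¬ri ∘ ⇒ adj-⊕ , ⇐ adj-⊕ rj)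

  separates-⊕⁺ : ∀ {r i j} → Separates P r i j → Separates (P ⊕ t) (r ↑ˡ t) (i ↑ˡ t) (j ↑ˡ t)
  separates-⊕⁺ (inj₁ (ri , ¬rj)) = inj₁ (⇒ adj-⊕ ri , ¬rj ∘ ⇐ adj-⊕)
  separates-⊕⁺ (inj₂ (¬ri , rj)) = inj₂ (¬ri ∘ ⇐ adj-⊕ , ⇒ adj-⊕ rj)

  -- A separating vertex has a neighbour, so it is not one of the added isolated vertices.
  separator-left : ∀ {r x y} → Separates (P ⊕ t) r x y → ∃ λ i → r ≡ i ↑ˡ t
  separator-left {r} sep with summand w t r
  ... | left i  = i , refl
  ... | right j with sep
  ...   | inj₁ (rx , _) = contradiction (adj-sym (P ⊕ t) rx) isolated
  ...   | inj₂ (_ , ry) = contradiction (adj-sym (P ⊕ t) ry) isolated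

  edgesAvoidable-⊕ : EdgesAvoidable P ⊎ 1 ≤ t → EdgesAvoidable (P ⊕ t)
  edgesAvoidable-⊕ h u v uv with summand w t u | summand w t v
  ... | right _ | _       = contradiction (adj-sym (P ⊕ t) uv) isolated
  ... | left _  | right _ = contradiction uv isolated
  edgesAvoidable-⊕ (inj₁ avoid) _ _ uv | left i | left j with avoid i j (⇐ adj-⊕ uv)
  ... | z , z≢i , z≢j , ¬zi , ¬zj =
    z ↑ˡ t , z≢i ∘ ↑ˡ-injective t _ _ , z≢j ∘ ↑ˡ-injective t _ _ , ¬zi ∘ ⇐ adj-⊕ , ¬zj ∘ ⇐ adj-⊕
  edgesAvoidable-⊕ (inj₂ (s≤s _)) _ _ uv | left i | left j =
    -- An isolated vertex avoids every edge. It differs from both ends because these have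
    -- neighbours.
    w ↑ʳ zero
    , (λ e → isolated (subst (Adj (P ⊕ t) (j ↑ˡ t)) (sym e) (adj-sym (P ⊕ t) uv)))
    , (λ e → isolated (subst (Adj (P ⊕ t) (i ↑ˡ t)) (sym e) uv))
    , isolated ∘ adj-sym (P ⊕ t) , isolated ∘ adj-sym (P ⊕ t)

  module _ {S : Subset w} {Q : Subset t} (loc : Locating (P ⊕ t) (S ++ Q)) where

    locating-⊕⁻ : Locating P S
    locating-⊕⁻ x x∉S y y∉S x≢y
      with loc (x ↑ˡ t) (x∉S ∘ ∈-++⁻ˡ) (y ↑ˡ t) (y∉S ∘ ∈-++⁻ˡ) (x≢y ∘ ↑ˡ-injective t x y)
    ... | r , r∈ , sep with separator-left sep
    ...   | i , refl = i , ∈-++⁻ˡ r∈ , separates-⊕⁻ sep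

    -- The missing isolated vertex `o` has no neighbours, so whatever separates `x` from `o` must be
    -- adjacent to `x`. This makes `S` dominating.
    locDom-⊕⁻ : ∀ {o} → o ∉ Q → LocDom P S
    locDom-⊕⁻ {o} o∉Q = dominating , locating-⊕⁻
      where
      dominating : Dominating P S
      dominating x x∉S
        with loc (x ↑ˡ t) (x∉S ∘ ∈-++⁻ˡ) (w ↑ʳ o) (o∉Q ∘ ∈-++⁻ʳ) ↑ˡ≢↑ʳ
        where
        ↑ˡ≢↑ʳ : x ↑ˡ t ≢ w ↑ʳ o
        ↑ˡ≢↑ʳ e with trans (sym (splitAt-↑ˡ w x t)) (trans (cong (splitAt w) e) (splitAt-↑ʳ w t o))
        ... | ()
      ... | r , r∈ , inj₂ (_ , ro) = contradiction ro isolated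
      ... | r , r∈ , sep@(inj₁ (rx , _)) with separator-left {y = w ↑ʳ o} sep
      ...   | i , refl = i , ∈-++⁻ˡ r∈ , ⇐ adj-⊕ rx

    -- Isolated vertices are twins, so at most one of them is left out.
    missing-unique : ∀ {o o′} → o ∉ Q → o′ ∉ Q → o ≡ o′
    missing-unique {o} {o′} o∉Q o′∉Q with o ≟ o′
    ... | yes o≡o′ = o≡o′
    ... | no o≢o′
      with loc (w ↑ʳ o) (o∉Q ∘ ∈-++⁻ʳ) (w ↑ʳ o′) (o′∉Q ∘ ∈-++⁻ʳ) (o≢o′ ∘ ↑ʳ-injective w o o′)
    ...   | _ , _ , inj₁ (ro , _)  = contradiction ro isolated
    ...   | _ , _ , inj₂ (_ , ro′) = contradiction ro′ isolated

  -- Two missing vertices of `P` are separated because `S` is locating. A missing vertex of `P` is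
  -- separated from `o` by its dominator. No second isolated vertex is missing.
  locating-⊕⁺ : ∀ {S} o → LocDom P S → Locating (P ⊕ t) (S ++ ∁ ⁅ o ⁆)
  locating-⊕⁺ {S} o (dom , loc) x x∉ y y∉ x≢y with summand w t x | summand w t y
  ... | left i | left j with loc i (x∉ ∘ ∈-++⁺ˡ) j (y∉ ∘ ∈-++⁺ˡ) (x≢y ∘ cong (_↑ˡ t))
  ...   | r , r∈S , sep = r ↑ˡ t , ∈-++⁺ˡ r∈S , separates-⊕⁺ sep
  locating-⊕⁺ {S} o (dom , loc) x x∉ y y∉ x≢y | left i | right j with dom i (x∉ ∘ ∈-++⁺ˡ)
  ... | r , r∈S , ri = r ↑ˡ t , ∈-++⁺ˡ r∈S , inj₁ (⇒ adj-⊕ ri , isolated)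
  locating-⊕⁺ {S} o (dom , loc) x x∉ y y∉ x≢y | right i | left j with dom j (y∉ ∘ ∈-++⁺ˡ)
  ... | r , r∈S , rj = r ↑ˡ t , ∈-++⁺ˡ r∈S , inj₂ (isolated , ⇒ adj-⊕ rj)
  locating-⊕⁺ {S} o (dom , loc) x x∉ y y∉ x≢y | right i | right j =
    contradiction (cong (w ↑ʳ_) (trans (missing i x∉) (sym (missing j y∉)))) x≢y
    where
    missing : ∀ j → w ↑ʳ j ∉ S ++ ∁ ⁅ o ⁆ → j ≡ o
    missing j j∉ = x∈⁅y⁆⇒x≡y o (x∉∁p⇒x∈p (j∉ ∘ ∈-++⁺ʳ {S = S}))

∣∁⁅⁆∣ : (o : Fin t) → ∣ ∁ ⁅ o ⁆ ∣ ≡ pred t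
∣∁⁅⁆∣ {suc t} o = trans (∣∁p∣≡n∸∣p∣ ⁅ o ⁆) (cong (suc t ∸_) (∣⁅x⁆∣≡1 o))

full⊎missing : (Q : Subset t) → ∣ Q ∣ ≡ t ⊎ ∃ (_∉ Q)
full⊎missing {t} Q with any? (λ o → ¬? (o ∈? Q))
... | yes missing = inj₂ missing
... | no full     = inj₁ (ℕ.≤-antisym (∣p∣≤n Q)
  (subst (_≤ ∣ Q ∣) (∣⊤∣≡n t) (p⊆q⇒∣p∣≤∣q∣ {p = ⊤} λ {x} _ → decidable-stable (x ∈? Q) λ x∉Q → full (x , x∉Q))))

module _ (P : Graph w) {t : ℕ} {S : Subset w} {Q : Subset t} (loc : Locating (P ⊕ t) (S ++ Q)) where

  -- As `o` is the only missing isolated vertex, `Q` contains the complement of `⁅ o ⁆`.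
  pred-t≤∣Q∣ : ∀ {o} → o ∉ Q → pred t ≤ ∣ Q ∣
  pred-t≤∣Q∣ {o} o∉Q = subst (_≤ ∣ Q ∣) (∣∁⁅⁆∣ o) (p⊆q⇒∣p∣≤∣q∣ λ {x} x∈ →
    decidable-stable (x ∈? Q) λ x∉Q → x∈∁p⇒x∉p x∈ (subst (_∈ ⁅ o ⁆) (missing-unique P loc o∉Q x∉Q) (x∈⁅x⁆ o)))

-- Graphs without forced vertices

Bounded : (Subset w → Set) → ℕ → Set
Bounded C k = ∀ S → C S → k ≤ ∣ S ∣

-- The first component supplies a set even if `w` is 0, where the second is vacuous. It is the part
-- in `P` of minimum sets that leave out a chosen isolated vertex.
Avoiding : (Subset w → Set) → ℕ → Set
Avoiding C k = (∃ λ S → ∣ S ∣ ≡ k × C S) × (∀ v → ∃ λ S → v ∉ S × ∣ S ∣ ≡ k × C S)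

module _ {C : Subset w → Set} (C? : ∀ S → Dec (C S)) where

  bounded? : ∀ k → Dec (Bounded C k)
  bounded? k = map′
    (λ none S c → ℕ.≮⇒≥ λ lt → none (S , lt , c))
    (λ bound (S , lt , c) → ℕ.<⇒≱ lt (bound S c))
    (¬? (anySubset? λ S → (∣ S ∣ ℕ.<? k) ×-dec C? S))

  avoiding? : ∀ k → Dec (Avoiding C k)
  avoiding? k = (anySubset? λ S → (∣ S ∣ ℕ.≟ k) ×-dec C? S)
    ×-dec all? λ v → anySubset? λ S → ¬? (v ∈? S) ×-dec (∣ S ∣ ℕ.≟ k) ×-dec C? S

module _ (P : Graph w) where

  -- The two conditions treat P together with at least one, respectively no, isolated vertex.
  Unforced : Set
  Unforced =
    (∃ λ (k : Fin (suc w)) →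
      Avoiding (LocDom P) (toℕ k) × Bounded (LocDom P) (toℕ k) × Bounded (Locating P) (pred (toℕ k)))
    × (6 ≤ w →
      (∃ λ (k : Fin (suc w)) → Avoiding (Locating P) (toℕ k) × Bounded (Locating P) (toℕ k))
      × EdgesAvoidable P)

  -- A subset of `Fin w` has at most `w` elements, so letting `k` range over `Fin (suc w)` turns its
  -- existence into a finite search.
  unforced? : Dec Unforced
  unforced? =
    any? (λ k → avoiding? (locDom? P) (toℕ k) ×-dec bounded? (locDom? P) (toℕ k)
      ×-dec bounded? (locating? P) (pred (toℕ k)))
    ×-dec (6 ℕ.≤? w →-dec
      any? (λ k → avoiding? (locating? P) (toℕ k) ×-dec bounded? (locating? P) (toℕ k))
      ×-dec edgesAvoidable? P)

  module _ (1≤t : 1 ≤ t) (ldBound : Bounded (LocDom P) k) (lBound : Bounded (Locating P) (pred k)) where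

    -- If `Q` misses a vertex, then `S` is locating-dominating and `Q` has at least `pred t`
    -- elements. If `Q` is full, `S` is merely known to be locating, which saves at most one vertex
    -- of `P`, and the additional vertex of `Q` makes up for it.
    ∣locating-⊕∣ : Bounded (Locating (P ⊕ t)) (k + pred t)
    ∣locating-⊕∣ R loc with Vec.splitAt w R
    ... | S , Q , refl = subst (k + pred t ≤_) (sym (∣++∣ S Q)) (bound (full⊎missing Q))
      where
      -- Only an inequality, since `pred zero` is `zero`.
      k≤1+pred : ∀ k → k ≤ suc (pred k)
      k≤1+pred zero    = z≤n
      k≤1+pred (suc k) = ℕ.≤-refl
      bound : ∣ Q ∣ ≡ t ⊎ ∃ (_∉ Q) → k + pred t ≤ ∣ S ∣ + ∣ Q ∣
      bound (inj₂ (o , o∉Q)) = ℕ.+-mono-≤ (ldBound S (locDom-⊕⁻ P loc o∉Q)) (pred-t≤∣Q∣ P loc o∉Q)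
      bound (inj₁ ∣Q∣≡t) = begin
        k + pred t            ≤⟨ ℕ.+-monoˡ-≤ (pred t) (k≤1+pred k) ⟩
        suc (pred k + pred t) ≡⟨ ℕ.+-suc (pred k) (pred t) ⟨
        pred k + suc (pred t) ≡⟨ cong (pred k +_) (ℕ.suc-pred t {{>-nonZero 1≤t}}) ⟩
        pred k + t            ≤⟨ ℕ.+-mono-≤ (lBound S (locating-⊕⁻ P loc)) (ℕ.≤-reflexive (sym ∣Q∣≡t)) ⟩
        ∣ S ∣ + ∣ Q ∣         ∎
        where open ℕ.≤-Reasoning

    minLocating-⊕ : ∀ {S} (o : Fin t) → ∣ S ∣ ≡ k → LocDom P S → MinLocating (P ⊕ t) (S ++ ∁ ⁅ o ⁆)
    minLocating-⊕ {S} o refl ld = locating-⊕⁺ P o ld , λ R′ loc →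
      subst (_≤ ∣ R′ ∣) (sym (trans (∣++∣ S (∁ ⁅ o ⁆)) (cong (∣ S ∣ +_) (∣∁⁅⁆∣ o)))) (∣locating-⊕∣ R′ loc)

  -- For positive `t`, a vertex of `P` is avoided by a suitable `S`, and an isolated vertex by
  -- making it the missing one. For `t` equal to 0, `P` is the whole graph, so `w` is at least 6 and
  -- the second half of `Unforced` applies.
  unforced-⊕ : Unforced → 6 ≤ w + t → ∀ v → ¬ Forced (P ⊕ t) v
  unforced-⊕ {suc t} ((k , (someS , avoiding) , ldBound , lBound) , _) _ v forced with summand w (suc t) v
  ... | left i with avoiding i
  ...   | S , i∉S , ∣S∣≡k , ld =
    i∉S (∈-++⁻ˡ (forced _ (minLocating-⊕ (s≤s z≤n) ldBound lBound zero ∣S∣≡k ld)))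
  unforced-⊕ {suc t} ((k , (someS , avoiding) , ldBound , lBound) , _) _ v forced | right j with someS
  ... | S , ∣S∣≡k , ld = x∈p⇒x∉∁p (x∈⁅x⁆ j)
    (∈-++⁻ʳ {S = S} (forced _ (minLocating-⊕ (s≤s z≤n) ldBound lBound j ∣S∣≡k ld)))
  unforced-⊕ {zero} (_ , noIsolated) 6≤w v forced with summand w 0 v
  ... | left i with noIsolated (subst (6 ≤_) (ℕ.+-identityʳ w) 6≤w)
  ...   | (k , (_ , avoiding) , bound) , _ with avoiding i
  ...     | S , i∉S , ∣S∣≡k , loc = i∉S (∈-++⁻ˡ (forced (S ++ []) (locating , minimal)))
    where
    locating : Locating (P ⊕ 0) (S ++ [])
    locating x x∉ y y∉ x≢y with summand w 0 x | summand w 0 y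
    ... | left i | left j with loc i (x∉ ∘ ∈-++⁺ˡ) j (y∉ ∘ ∈-++⁺ˡ) (x≢y ∘ cong (_↑ˡ 0))
    ...   | r , r∈S , sep = r ↑ˡ 0 , ∈-++⁺ˡ r∈S , separates-⊕⁺ P sep
    minimal : ∀ R → Locating (P ⊕ 0) R → ∣ S ++ [] ∣ ≤ ∣ R ∣
    minimal R loc′ with Vec.splitAt w R
    ... | S′ , [] , refl = subst₂ _≤_ (sym (∣++∣ S [])) (sym (∣++∣ S′ []))
      (ℕ.+-monoˡ-≤ 0 (subst (_≤ ∣ S′ ∣) (sym ∣S∣≡k) (bound S′ (locating-⊕⁻ P loc′))))

-- The path P₅

inner : Subset 5
inner = outside ∷ inside ∷ outside ∷ inside ∷ outside ∷ []

inner-locDom : LocDom (pathGraph 5) inner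
inner-locDom = from-yes (locDom? (pathGraph 5) inner)

path-locating≥2 : Bounded (Locating (pathGraph 5)) 2
path-locating≥2 = from-yes (bounded? (locating? (pathGraph 5)) 2)

path-locDom≥2 : Bounded (LocDom (pathGraph 5)) 2
path-locDom≥2 S (_ , loc) = path-locating≥2 S loc

path-locDom-inner : ∀ S → ∣ S ∣ ≤ 2 → LocDom (pathGraph 5) S → inner ⊆ S
path-locDom-inner S ∣S∣≤2 ld {x} x∈inner = decidable-stable (x ∈? S) λ x∉S →
  -- All subsets of `Fin 5` are searched for a counterexample.
  from-yes (¬? (anySubset? λ S → (∣ S ∣ ℕ.≤? 2) ×-dec any? (λ x → (x ∈? inner) ×-dec ¬? (x ∈? S))
    ×-dec locDom? (pathGraph 5) S)) (S , ∣S∣≤2 , (x , x∈inner , x∉S) , ld)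

-- The minimum size is `2 + pred t`. It leaves no room for a full `Q`, so one isolated vertex is
-- missing and `S` contains `inner`. Every isolated vertex can be the missing one, so none of them
-- is forced.
path-forced : 1 ≤ t → ∀ v → Forced (pathGraph 5 ⊕ t) v ⇔ v ∈ inner ++ ⊥ {t}
path-forced {t} 1≤t@(s≤s _) v = mk⇔ forced⇒inner (inner⇒forced v)
  where
  P = pathGraph 5

  minimum : ∀ o → MinLocating (P ⊕ t) (inner ++ ∁ ⁅ o ⁆)
  -- Locating sets need the bound `pred 2`, that is 1, here weakened from 2.
  minimum o = minLocating-⊕ P 1≤t path-locDom≥2 (λ S → ℕ.<⇒≤ ∘ path-locating≥2 S) o refl inner-locDom

  forced⇒inner : Forced (P ⊕ t) v → v ∈ inner ++ ⊥
  forced⇒inner forced with summand 5 t v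
  ... | left i  = ∈-++⁺ˡ (∈-++⁻ˡ {S = inner} (forced _ (minimum zero)))
  ... | right j = contradiction (∈-++⁻ʳ {S = inner} (forced _ (minimum j))) (x∈p⇒x∉∁p (x∈⁅x⁆ j))

  inner⇒forced : ∀ v → v ∈ inner ++ ⊥ → Forced (P ⊕ t) v
  inner⇒forced v v∈ R (loc , min) with Vec.splitAt 5 R
  ... | S , Q , refl with summand 5 t v
  ...   | right j = contradiction (∈-++⁻ʳ {S = inner} v∈) ∉⊥
  ...   | left i  = ∈-++⁺ˡ (inner⊆S (full⊎missing Q) (∈-++⁻ˡ {S = inner} v∈))
    where
    ∣R∣≤ : ∣ S ∣ + ∣ Q ∣ ≤ 2 + pred t
    ∣R∣≤ = subst₂ _≤_ (∣++∣ S Q) (cong (2 +_) (∣∁⁅⁆∣ {t} zero)) (min _ (proj₁ (minimum zero)))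

    inner⊆S : ∣ Q ∣ ≡ t ⊎ ∃ (_∉ Q) → inner ⊆ S
    inner⊆S (inj₂ (o , o∉Q)) = path-locDom-inner S
      (ℕ.+-cancelʳ-≤ (pred t) ∣ S ∣ 2 (ℕ.≤-trans (ℕ.+-monoʳ-≤ ∣ S ∣ (pred-t≤∣Q∣ P loc o∉Q)) ∣R∣≤))
      (locDom-⊕⁻ P loc o∉Q)
    -- A full `Q` would give size at least `2 + t`, but `2 + pred t` computes to `1 + t` because `t`
    -- is a successor.
    inner⊆S (inj₁ ∣Q∣≡t) = contradiction
      (ℕ.+-cancelʳ-≤ t 2 1 (ℕ.≤-trans (ℕ.+-mono-≤ (path-locating≥2 S (locating-⊕⁻ P loc)) (ℕ.≤-reflexive (sym ∣Q∣≡t))) ∣R∣≤))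
      λ { (s≤s ()) }

-- Graphs from edge lists

EdgeList : ℕ → Set
EdgeList n = List (Fin n × Fin n)

Joins : Fin n → Fin n → Fin n × Fin n → Set
Joins u v (a , b) = (u ≡ a × v ≡ b) ⊎ (u ≡ b × v ≡ a)

joins-sym : ∀ {u v : Fin n} {e} → Joins u v e → Joins v u e
joins-sym (inj₁ (p , q)) = inj₂ (q , p)
joins-sym (inj₂ (p , q)) = inj₁ (q , p)

-- Loops are discarded by `u ≢ v` and repetitions do not affect `Any`, so every list yields a simple
-- graph. The enumeration below does produce lists with repeated edges.
fromEdges : EdgeList n → Graph n
fromEdges es = record
  { Adj        = λ u v → u ≢ v × Any (Joins u v) es
  ; adj?       = λ u v → ¬? (u ≟ v) ×-dec
      Any.any? (λ (a , b) → ((u ≟ a) ×-dec (v ≟ b)) ⊎-dec ((u ≟ b) ×-dec (v ≟ a))) es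
  ; adj-sym    = λ (u≢v , uv) → u≢v ∘ sym , Any.map joins-sym uv
  ; adj-irrefl = λ u≡v (u≢v , _) → u≢v u≡v
  }

edges⇒adj : (H : Graph n) → ∀ {u v} → (u , v) Membership.∈ edges H → Adj H u v
edges⇒adj {n} H e∈ = proj₂ (proj₂ (∈-filter⁻ (λ (i , j) → (i <? j) ×-dec adj? H i j)
  {xs = cartesianProduct (allFin n) (allFin n)} e∈))

adj⇔edges : (H : Graph n) → ∀ u v → Adj H u v ⇔ Any (Joins u v) (edges H)
adj⇔edges H u v = mk⇔ to from
  where
  edge∈ : ∀ {i j} → i < j → Adj H i j → (i , j) Membership.∈ edges H
  edge∈ {i} {j} i<j ij =
    ∈-filter⁺ _ (∈-cartesianProduct⁺ (∈-allFin i) (∈-allFin j)) (i<j , ij)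
  to : Adj H u v → Any (Joins u v) (edges H)
  to uv with <-cmp u v
  ... | tri< u<v _ _  = Any.map (λ { refl → inj₁ (refl , refl) }) (edge∈ u<v uv)
  ... | tri≈ _ u≡v _  = contradiction uv (adj-irrefl H u≡v)
  ... | tri> _ _ v<u  = Any.map (λ { refl → inj₂ (refl , refl) }) (edge∈ v<u (adj-sym H uv))
  from : Any (Joins u v) (edges H) → Adj H u v
  from uv with Membership.find uv
  ... | _ , e∈ , inj₁ (refl , refl) = edges⇒adj H e∈
  ... | _ , e∈ , inj₂ (refl , refl) = adj-sym H (edges⇒adj H e∈)

edges-irrefl : (H : Graph n) → All (λ (u , v) → u ≢ v) (edges H)
edges-irrefl H = All.tabulate λ e∈ u≡v → adj-irrefl H u≡v (edges⇒adj H e∈)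

-- Enumeration of the edge lists of given length

every : (Fin n → Bool) → Bool
every {zero}  p = true
every {suc n} p = p zero ∧ every (p ∘ suc)

every-sound : (p : Fin n → Bool) → T (every p) → ∀ i → T (p i)
every-sound p h zero    = proj₁ (⇒ T-∧ h)
every-sound p h (suc i) = every-sound (p ∘ suc) (proj₂ (⇒ (T-∧ {p zero}) h)) i

implied : ∀ {A : Set} {b} (A? : Dec A) → T (not (does A?) ∨ b) → A → T b
implied (yes _) h _ = h
implied (no ¬a) _ a = contradiction a ¬a

shift : EdgeList w → EdgeList (suc w)
shift = List.map λ (i , j) → suc i , suc j

module _ {Q : ∀ {w} → EdgeList w → Set} (Q? : ∀ {w} (es : EdgeList w) → Dec (Q es)) where

  -- Do all extensions of es by k edges satisfy Q? The vertices of es are Fin w; each new edge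
  -- has two, one or no end among them, and new vertices are inserted at the front.
  -- (This is Boolean-valued because a Dec would retain the proofs of all cases in memory.)
  explored oldOld newOld : ℕ → EdgeList w → Bool
  explored zero    es = ⌊ Q? es ⌋
  explored (suc k) es = oldOld k es ∧ newOld k es ∧ explored k ((zero , suc zero) ∷ shift (shift es))

  oldOld k es = every λ i → every λ j → not (does (i <? j)) ∨ explored k ((i , j) ∷ es)
  newOld k es = every λ i → explored k ((zero , suc i) ∷ shift es)

  module _ (es : EdgeList w) (h : T (explored (suc k) es)) where

    private
      h′ = ⇒ (T-∧ {oldOld k es}) h
      h″ = ⇒ (T-∧ {newOld k es}) (proj₂ h′)

    explored-oldOld : ∀ {i j} → i < j → T (explored k ((i , j) ∷ es))
    explored-oldOld {i} {j} i<j = implied (i <? j) (every-sound _ (every-sound _ (proj₁ h′) i) j) i<j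

    explored-newOld : ∀ i → T (explored k ((zero , suc i) ∷ shift es))
    explored-newOld = every-sound _ (proj₁ h″)

    explored-newNew : T (explored k ((zero , suc zero) ∷ shift (shift es)))
    explored-newNew = proj₂ h″

-- Edges correspond position by position, but only up to orientation. Hence it suffices to enumerate
-- pairs of old vertices with `i < j`, although `f` need not be monotone.
Drawn : (Fin w → Fin n) → EdgeList w → EdgeList n → Set
Drawn f = Pointwise λ (i , j) → Joins (f i) (f j)

drawn-shift : ∀ {f : Fin w → Fin n} {es L} x → Drawn f es L → Drawn (x Functional.∷ f) (shift es) L
drawn-shift x []      = []
drawn-shift x (p ∷ d) = p ∷ drawn-shift x d

∷-injective : ∀ {f : Fin w → Fin n} {x} → Injective _≡_ _≡_ f → (∀ i → f i ≢ x) → Injective _≡_ _≡_ (x Functional.∷ f)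
∷-injective inj x∉ {zero}  {zero}  _ = refl
∷-injective inj x∉ {zero}  {suc j} e = contradiction (sym e) (x∉ j)
∷-injective inj x∉ {suc i} {zero}  e = contradiction e (x∉ i)
∷-injective inj x∉ {suc i} {suc j} e = cong suc (inj e)

module _ {f : Fin w → Fin n} (f-inj : Injective _≡_ _≡_ f) where

  drawn⁻ : ∀ {es L i j} → Drawn f es L → Any (Joins (f i) (f j)) L → Any (Joins i j) es
  drawn⁻ (p ∷ d) (there q) = there (drawn⁻ d q)
  drawn⁻ (inj₁ (refl , refl) ∷ d) (here (inj₁ (p , q))) = here (inj₁ (f-inj p , f-inj q))
  drawn⁻ (inj₁ (refl , refl) ∷ d) (here (inj₂ (p , q))) = here (inj₂ (f-inj p , f-inj q))
  drawn⁻ (inj₂ (refl , refl) ∷ d) (here (inj₁ (p , q))) = here (inj₂ (f-inj p , f-inj q))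
  drawn⁻ (inj₂ (refl , refl) ∷ d) (here (inj₂ (p , q))) = here (inj₁ (f-inj p , f-inj q))

drawn⁺ : ∀ {f : Fin w → Fin n} {es L i j} → Drawn f es L → Any (Joins i j) es → Any (Joins (f i) (f j)) L
drawn⁺ (p ∷ d) (there q)                  = there (drawn⁺ d q)
drawn⁺ (p ∷ d) (here (inj₁ (refl , refl))) = here p
drawn⁺ (p ∷ d) (here (inj₂ (refl , refl))) = here (joins-sym p)

-- Consequently the vertices outside the image of `f` are isolated in the graph that is drawn.
drawn-covers : ∀ {f : Fin w → Fin n} {es L u v} → Drawn f es L → Any (Joins u v) L → ∃ λ i → f i ≡ u
drawn-covers (p ∷ d) (there q) = drawn-covers d q
drawn-covers (_∷_ {x = i , j} (inj₁ (p , q)) d) (here (inj₁ (refl , refl))) = i , p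
drawn-covers (_∷_ {x = i , j} (inj₁ (p , q)) d) (here (inj₂ (refl , refl))) = j , q
drawn-covers (_∷_ {x = i , j} (inj₂ (p , q)) d) (here (inj₁ (refl , refl))) = j , q
drawn-covers (_∷_ {x = i , j} (inj₂ (p , q)) d) (here (inj₂ (refl , refl))) = i , p

module _ {Q : ∀ {w} → EdgeList w → Set} (Q? : ∀ {w} (es : EdgeList w) → Dec (Q es)) where

  Drawing : ℕ → EdgeList n → Set
  Drawing {n} k L = ∃ λ w → ∃ λ (es : EdgeList w) → ∃ λ (f : Fin w → Fin n) →
    T (explored Q? k es) × Injective _≡_ _≡_ f × Drawn f es L

  -- The branch of the search is chosen by which ends of the new edge are already in the image of
  -- `f`.
  draw-edge : ∀ {L : EdgeList n} {u v} → u ≢ v → Drawing (suc k) L → Drawing k ((u , v) ∷ L)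
  draw-edge {k = k} {u = u} {v} u≢v (w , es , f , h , f-inj , drawn)
    with any? (λ i → f i ≟ u) | any? (λ j → f j ≟ v)
  ... | yes (i , refl) | yes (j , refl) with <-cmp i j
  ...   | tri< i<j _ _  = w , (i , j) ∷ es , f , explored-oldOld Q? {k = k} es h i<j , f-inj , inj₁ (refl , refl) ∷ drawn
  ...   | tri≈ _ refl _ = contradiction refl u≢v
  ...   | tri> _ _ j<i  = w , (j , i) ∷ es , f , explored-oldOld Q? {k = k} es h j<i , f-inj , inj₂ (refl , refl) ∷ drawn
  -- The new vertex `v` takes position `zero`, so the listed pair has the reverse orientation of
  -- `(u , v)`.
  draw-edge {k = k} {u = u} {v} u≢v (w , es , f , h , f-inj , drawn) | yes (i , refl) | no v∉ =
    suc w , (zero , suc i) ∷ shift es , v Functional.∷ f , explored-newOld Q? {k = k} es h i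
    , ∷-injective f-inj (λ j e → v∉ (j , e)) , inj₂ (refl , refl) ∷ drawn-shift v drawn
  draw-edge {k = k} {u = u} {v} u≢v (w , es , f , h , f-inj , drawn) | no u∉ | yes (j , refl) =
    suc w , (zero , suc j) ∷ shift es , u Functional.∷ f , explored-newOld Q? {k = k} es h j
    , ∷-injective f-inj (λ i e → u∉ (i , e)) , inj₁ (refl , refl) ∷ drawn-shift u drawn
  draw-edge {k = k} {u = u} {v} u≢v (w , es , f , h , f-inj , drawn) | no u∉ | no v∉ =
    suc (suc w) , (zero , suc zero) ∷ shift (shift es) , u Functional.∷ v Functional.∷ f , explored-newNew Q? {k = k} es h
    , ∷-injective (∷-injective f-inj (λ j e → v∉ (j , e)))
        (λ { zero e → u≢v (sym e) ; (suc i) e → u∉ (i , e) })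
    , inj₁ (refl , refl) ∷ drawn-shift u (drawn-shift v drawn)

  -- Here `k` is the number of edges that the search may still add after `L`. The tail is drawn
  -- first, with `suc k` edges left, and the head uses one of them.
  draw : (L : EdgeList n) → All (λ (u , v) → u ≢ v) L → T (explored Q? {w = 0} (length L + k) []) → Drawing k L
  draw         []             []          h = 0 , [] , (λ ()) , h , (λ { {()} }) , []
  draw {k = k} ((u , v) ∷ L) (u≢v ∷ irr) h =
    draw-edge {k = k} u≢v (draw {k = suc k} L irr (subst (λ k → T (explored Q? {w = 0} k [])) (sym (ℕ.+-suc (length L) k)) h))

-- Splitting off isolated vertices

-- An induced copy of `P` in `H` that, by `covers`, contains every vertex having a neighbour. All
-- other vertices of `H` are isolated.
record Embedding (P : Graph w) (H : Graph n) : Set where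
  field
    map       : Fin w → Fin n
    injective : Injective _≡_ _≡_ map
    adj⇔      : ∀ i j → Adj H (map i) (map j) ⇔ Adj P i j
    covers    : ∀ {u v} → Adj H u v → ∃ λ i → map i ≡ u

-- Drawing the edges of `H` one after another follows a branch of the search, and the list at its
-- leaf satisfies `Q`.
embed : ∀ {Q : ∀ {w} → EdgeList w → Set} (Q? : ∀ {w} (es : EdgeList w) → Dec (Q es)) (H : Graph n) →
  explored Q? {w = 0} (numEdges H) [] ≡ true → ∃ λ w → ∃ λ (es : EdgeList w) → Q es × Embedding (fromEdges es) H
embed Q? H h with draw Q? {k = 0} (edges H) (edges-irrefl H)
  (⇐ T-≡ (subst (λ k → explored Q? {w = 0} k [] ≡ true) (sym (ℕ.+-identityʳ (numEdges H))) h))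
... | w , es , f , q , f-inj , drawn = w , es , toWitness {a? = Q? es} q , record
  { map       = f
  ; injective = f-inj
  ; adj⇔      = λ i j → mk⇔
      (λ ij → (λ i≡j → adj-irrefl H (cong f i≡j) ij) , drawn⁻ f-inj drawn (⇒ (adj⇔edges H _ _) ij))
      (λ (_ , ij) → ⇐ (adj⇔edges H _ _) (drawn⁺ drawn ij))
  ; covers    = λ {u} {v} uv → drawn-covers drawn (⇒ (adj⇔edges H u v) uv)
  }

lookup-injective : ∀ {A : Set} {xs : List A} → Unique xs → Injective _≡_ _≡_ (List.lookup xs)
lookup-injective (_ ∷ _)  {zero}  {zero}  _ = refl
lookup-injective (x∉ ∷ _) {zero}  {suc j} e = contradiction e (All.lookup x∉ (∈-lookup j))
lookup-injective (x∉ ∷ _) {suc i} {zero}  e = contradiction (sym e) (All.lookup x∉ (∈-lookup i))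
lookup-injective (_ ∷ u)  {suc i} {suc j} e = cong suc (lookup-injective u e)

module _ {P : Graph w} {H : Graph n} (emb : Embedding P H) where

  open Embedding emb

  private
    covered? : Decidable (λ v → ∃ λ i → map i ≡ v)
    covered? v = any? λ i → map i ≟ v

    rest : List (Fin n)
    rest = filter (¬? ∘ covered?) (allFin n)

    uncovered : ∀ j → ¬ ∃ λ i → map i ≡ List.lookup rest j
    uncovered j = proj₂ (∈-filter⁻ (¬? ∘ covered?) {xs = allFin n} (∈-lookup {xs = rest} j))

    fromSum : Fin w ⊎ Fin (length rest) → Fin n
    fromSum = [ map , List.lookup rest ]′

    fromSum-injective : Injective _≡_ _≡_ fromSum
    fromSum-injective {inj₁ i} {inj₁ j} e = cong inj₁ (injective e)
    fromSum-injective {inj₁ i} {inj₂ j} e = contradiction (i , e) (uncovered j)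
    fromSum-injective {inj₂ i} {inj₁ j} e = contradiction (j , sym e) (uncovered i)
    fromSum-injective {inj₂ i} {inj₂ j} e =
      cong inj₂ (lookup-injective (Unique.filter⁺ (¬? ∘ covered?) (Unique.allFin⁺ n)) e)

    locate : ∀ v → ∃ λ s → fromSum s ≡ v
    locate v with covered? v
    ... | yes (i , e) = inj₁ i , e
    ... | no v∉       = inj₂ (Any.index v∈) , sym (lookup-index v∈)
      where v∈ = ∈-filter⁺ (¬? ∘ covered?) (∈-allFin v) v∉

    sum↔ : Fin n ↔ (Fin w ⊎ Fin (length rest))
    sum↔ = mk↔ₛ′ (proj₁ ∘ locate) fromSum
      (λ s → fromSum-injective (proj₂ (locate (fromSum s)))) (proj₂ ∘ locate)

    sumAdj : ∀ s s′ → Adj H (fromSum s) (fromSum s′) ⇔ SumAdj P (edgeless (length rest)) s s′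
    sumAdj (inj₁ i) (inj₁ j) = adj⇔ i j
    sumAdj (inj₁ i) (inj₂ j) = mk⇔ (λ ij → uncovered j (covers (adj-sym H ij))) λ ()
    sumAdj (inj₂ i) (inj₁ j) = mk⇔ (λ ij → uncovered i (covers ij)) λ ()
    sumAdj (inj₂ i) (inj₂ j) = mk⇔ (λ ij → uncovered i (covers ij)) λ ()

  -- The covered vertices are enumerated by `map` and the remaining ones by `rest`. Together they
  -- give a bijection, which also yields the equation for `n`.
  embedding⇒isomorphic : ∃ λ t → n ≡ w + t × Isomorphic H (P ⊕ t)
  embedding⇒isomorphic = length rest , ↔⇒≡ f , f , adj
    where
    f = ↔-trans sum↔ (↔-sym +↔⊎)
    adj : ∀ u v → Adj H u v ⇔ Adj (P ⊕ length rest) (Inverse.to f u) (Inverse.to f v)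
    -- Adjacency in the disjoint union is tested after `splitAt`, which undoes the `join` in `f`.
    adj u v rewrite splitAt-join w (length rest) (proj₁ (locate u)) | splitAt-join w (length rest) (proj₁ (locate v)) =
      subst₂ (λ x y → Adj H x y ⇔ SumAdj P (edgeless (length rest)) (proj₁ (locate u)) (proj₁ (locate v)))
        (proj₂ (locate u)) (proj₂ (locate v)) (sumAdj (proj₁ (locate u)) (proj₁ (locate v)))

-- Recognition of P₅ and the finite check

-- The adjacencies along the path stand between the quantifiers so that the search abandons a false
-- start early.
IsPath₅ : Graph w → Set
IsPath₅ P = ∃ λ a → ∃ λ b → Adj P a b × ∃ λ c → Adj P b c × ∃ λ d → Adj P c d × ∃ λ e → Adj P d e ×
  let p = lookup (a ∷ b ∷ c ∷ d ∷ e ∷ []) in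
  (∀ i j → p i ≡ p j → i ≡ j) × (∀ x → ∃ λ i → p i ≡ x)
  × (∀ i j → (Adj P (p i) (p j) → Adj (pathGraph 5) i j) × (Adj (pathGraph 5) i j → Adj P (p i) (p j)))

isPath₅? : (P : Graph w) → Dec (IsPath₅ P)
isPath₅? P = any? λ a → any? λ b → adj? P a b ×-dec any? λ c → adj? P b c ×-dec
  any? λ d → adj? P c d ×-dec any? λ e → adj? P d e ×-dec
  let p = lookup (a ∷ b ∷ c ∷ d ∷ e ∷ []) in
  (all? λ i → all? λ j → p i ≟ p j →-dec i ≟ j) ×-dec (all? λ x → any? λ i → p i ≟ x)
  ×-dec (all? λ i → all? λ j → (adj? P (p i) (p j) →-dec adj? (pathGraph 5) i j)
    ×-dec (adj? (pathGraph 5) i j →-dec adj? P (p i) (p j)))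

path-embedding : {P : Graph w} {H : Graph n} → IsPath₅ P → Embedding P H → Embedding (pathGraph 5) H
path-embedding (a , b , _ , c , _ , d , _ , e , _ , p-inj , p-surj , p-adj) emb = record
  { map       = map ∘ p
  ; injective = p-inj _ _ ∘ injective
  ; adj⇔      = λ i j → mk⇔ (proj₁ (p-adj i j) ∘ ⇒ (adj⇔ _ _)) (⇐ (adj⇔ _ _) ∘ proj₂ (p-adj i j))
  ; covers    = λ uv → covers′ (covers uv)
  }
  where
  open Embedding emb
  p = lookup (a ∷ b ∷ c ∷ d ∷ e ∷ [])
  covers′ : ∀ {u} → ∃ (λ x → map x ≡ u) → ∃ λ i → map (p i) ≡ u
  covers′ (x , e) with p-surj x
  ... | i , refl = i , e

unforcedEdges? : (es : EdgeList w) → Dec (Unforced (fromEdges es))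
unforcedEdges? es = unforced? (fromEdges es)

pathOrUnforced? : (es : EdgeList w) → Dec (IsPath₅ (fromEdges es) ⊎ Unforced (fromEdges es))
pathOrUnforced? es = isPath₅? (fromEdges es) ⊎-dec unforced? (fromEdges es)

-- The next two statements are equations, and have a variable k, for speed: type checking an
-- element of T (explored …) is far slower, and closed instances would be re-evaluated at each use.
fewEdges-unforced : ∀ {k} → k ≤ 3 → explored unforcedEdges? {w = 0} k [] ≡ true
fewEdges-unforced z≤n                   = refl
fewEdges-unforced (s≤s z≤n)             = refl
fewEdges-unforced (s≤s (s≤s z≤n))       = refl
fewEdges-unforced (s≤s (s≤s (s≤s z≤n))) = refl

fourEdges-path⊎unforced : ∀ {k} → k ≡ 4 → explored pathOrUnforced? {w = 0} k [] ≡ true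
fourEdges-path⊎unforced refl = refl

-- Counting edges

module _ {A : Set} {P Q R : Pred A 0ℓ} (P? : Decidable P) (Q? : Decidable Q) (R? : Decidable R)
  (P⇒R : ∀ {x} → P x → R x) (Q⇒R : ∀ {x} → Q x → R x) (R⇒P⊎Q : ∀ {x} → R x → P x ⊎ Q x) (disjoint : ∀ {x} → P x → ¬ Q x)
  where

  length-filter-⊎ : ∀ xs → length (filter P? xs) + length (filter Q? xs) ≡ length (filter R? xs)
  length-filter-⊎ [] = refl
  length-filter-⊎ (x ∷ xs) with P? x | Q? x | R? x
  ... | yes p | yes q | _     = contradiction q (disjoint p)
  ... | yes _ | no _  | yes _ = cong suc (length-filter-⊎ xs)
  ... | yes p | no _  | no ¬r = contradiction (P⇒R p) ¬r
  ... | no _  | yes _ | yes _ = trans (ℕ.+-suc (length (filter P? xs)) _) (cong suc (length-filter-⊎ xs))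
  ... | no _  | yes q | no ¬r = contradiction (Q⇒R q) ¬r
  ... | no ¬p | no ¬q | yes r = contradiction (R⇒P⊎Q r) [ ¬p , ¬q ]′
  ... | no _  | no _  | no _  = length-filter-⊎ xs

ascending : EdgeList n → ℕ
ascending = length ∘ filter λ (i , j) → i <? j

ascending-++ : (xs ys : EdgeList n) → ascending (xs List.++ ys) ≡ ascending xs + ascending ys
ascending-++ xs ys = trans (cong length (filter-++ _ xs ys)) (length-++ (filter _ xs))

-- No pair `(suc x , zero)` is ascending, and `suc` preserves and reflects the order.
ascending-suc : (xs ys : List (Fin n)) →
  ascending (cartesianProduct (List.map suc xs) (zero ∷ List.map suc ys)) ≡ ascending (cartesianProduct xs ys)
ascending-suc []       ys = refl
ascending-suc (x ∷ xs) ys = begin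
  ascending (List.map (suc x ,_) (zero ∷ List.map suc ys) List.++ cartesianProduct (List.map suc xs) (zero ∷ List.map suc ys))
    ≡⟨ ascending-++ (List.map (suc x ,_) (zero ∷ List.map suc ys)) _ ⟩
  ascending (List.map (suc x ,_) (List.map suc ys)) + ascending (cartesianProduct (List.map suc xs) (zero ∷ List.map suc ys))
    ≡⟨ cong₂ _+_ (row ys) (ascending-suc xs ys) ⟩
  ascending (List.map (x ,_) ys) + ascending (cartesianProduct xs ys)
    ≡⟨ ascending-++ (List.map (x ,_) ys) _ ⟨
  ascending (cartesianProduct (x ∷ xs) ys) ∎
  where
  open ≡-Reasoning
  row : ∀ ys → ascending (List.map (suc x ,_) (List.map suc ys)) ≡ ascending (List.map (x ,_) ys)
  row []       = refl
  row (y ∷ ys) with does (x <? y)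
  ... | true  = cong suc (row ys)
  ... | false = row ys

numPairs : ℕ → ℕ
numPairs n = ascending (cartesianProduct (allFin n) (allFin n))

numPairs-suc : ∀ n → numPairs (suc n) ≡ n + numPairs n
numPairs-suc n = begin
  numPairs (suc n)
    ≡⟨ ascending-++ (List.map (zero ,_) (allFin (suc n))) _ ⟩
  firstRow (List.tabulate {n = n} suc) + otherRows (List.tabulate {n = n} suc)
    -- The tail of `allFin (suc n)` is brought into the form `List.map suc (allFin n)`, to which
    -- `row` and `ascending-suc` apply.
    ≡⟨ cong (λ xs → firstRow xs + otherRows xs) (map-tabulate {n = n} (λ i → i) suc) ⟨
  firstRow (List.map suc (allFin n)) + otherRows (List.map suc (allFin n))
    ≡⟨ cong₂ _+_ (trans (row (allFin n)) (length-tabulate {n = n} (λ i → i))) (ascending-suc (allFin n) (allFin n)) ⟩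
  n + numPairs n ∎
  where
  open ≡-Reasoning
  firstRow otherRows : List (Fin (suc n)) → ℕ
  firstRow xs = ascending (List.map (zero ,_) xs)
  otherRows xs = ascending (cartesianProduct xs (zero ∷ xs))
  row : ∀ xs → firstRow (List.map suc xs) ≡ length xs
  row []       = refl
  row (x ∷ xs) = cong suc (row xs)

-- Doubling keeps division out of the induction.
numPairs*2 : ∀ n → numPairs n * 2 ≡ n * (n ∸ 1)
numPairs*2 zero    = refl
numPairs*2 (suc n) = begin
  numPairs (suc n) * 2      ≡⟨ cong (_* 2) (numPairs-suc n) ⟩
  (n + numPairs n) * 2      ≡⟨ ℕ.*-distribʳ-+ 2 n (numPairs n) ⟩
  n * 2 + numPairs n * 2    ≡⟨ cong (n * 2 +_) (numPairs*2 n) ⟩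
  n * 2 + n * (n ∸ 1)       ≡⟨ ℕ.*-distribˡ-+ n 2 (n ∸ 1) ⟨
  n * (2 + (n ∸ 1))         ≡⟨ lemma n ⟩
  suc n * n                 ∎
  where
  open ≡-Reasoning
  -- The case split takes care of the truncated `n ∸ 1` at 0.
  lemma : ∀ n → n * (2 + (n ∸ 1)) ≡ suc n * n
  lemma zero    = refl
  lemma (suc n) = ℕ.*-comm (suc n) (suc (suc n))

-- Each pair `i < j` is an edge of exactly one of the two graphs.
numEdges-complement : (G : Graph n) → numEdges G + numEdges (complement G) ≡ n * (n ∸ 1) / 2
numEdges-complement {n} G = begin
  numEdges G + numEdges (complement G) ≡⟨ length-filter-⊎
    (λ (i , j) → (i <? j) ×-dec adj? G i j) (λ (i , j) → (i <? j) ×-dec adj? (complement G) i j) (λ (i , j) → i <? j)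
    proj₁ proj₁ split (λ (_ , ij) (_ , _ , ¬ij) → ¬ij ij) (cartesianProduct (allFin n) (allFin n)) ⟩
  numPairs n                           ≡⟨ m*n/n≡m (numPairs n) 2 ⟨
  numPairs n * 2 / 2                   ≡⟨ cong (_/ 2) (numPairs*2 n) ⟩
  n * (n ∸ 1) / 2                      ∎
  where
  open ≡-Reasoning
  split : ∀ {(i , j) : Fin n × Fin n} → i < j → (i < j × Adj G i j) ⊎ (i < j × Adj (complement G) i j)
  split {i , j} i<j with adj? G i j
  ... | yes ij = inj₁ (i<j , ij)
  ... | no ¬ij = inj₂ (i<j , (λ { refl → ℕ.<-irrefl refl i<j }) , ¬ij)

-- Graphs whose complement has at most four edges

module _ (G : Graph n) (6≤n : 6 ≤ n) where

  unforced⇒¬basisForced : {P : Graph w} → Unforced P → Embedding P (complement G) → ∀ v → ¬ BasisForced G v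
  unforced⇒¬basisForced {w} {P} unforced@(_ , noIsolated) emb v forced with embedding⇒isomorphic emb
  ... | t , n≡w+t , iso = unforced-⊕ P {t = t} unforced 6≤w+t _
    (⇒ (forced-iso (complement G) (P ⊕ t) iso v) (⇒ (basisForced⇔forced G avoid v) forced))
    where
    6≤w+t = subst (6 ≤_) n≡w+t 6≤n
    -- The diameter bound comes from an isolated vertex of the complement if there is one, and
    -- otherwise from the second half of `Unforced`.
    avoid⊎ : ∀ t → 6 ≤ w + t → EdgesAvoidable P ⊎ 1 ≤ t
    avoid⊎ zero    6≤w+0 = inj₁ (proj₂ (noIsolated (subst (6 ≤_) (ℕ.+-identityʳ w) 6≤w+0)))
    avoid⊎ (suc t) _     = inj₂ (s≤s z≤n)
    avoid = edgesAvoidable-iso (complement G) (P ⊕ t) iso (edgesAvoidable-⊕ P (avoid⊎ t 6≤w+t))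

  path⇒basisForced : Embedding (pathGraph 5) (complement G) →
    Isomorphic (complement G) (disjointUnion (pathGraph 5) (edgeless (n ∸ 5)))
    × ∃ λ (F : Subset n) → ∣ F ∣ ≡ 2 × (∀ v → v ∈ F ⇔ BasisForced G v)
  path⇒basisForced emb with embedding⇒isomorphic emb
  -- Matching on `n ≡ 5 + t` lets `n ∸ 5` compute to `t`. The set `F` consists of the vertices of
  -- `G` that correspond to the second and fourth vertex of the path.
  ... | t , refl , iso@(f , _) = iso , F , ∣F∣≡2 , ∈F⇔
    where
    1≤t : 1 ≤ t
    1≤t = ℕ.+-cancelˡ-≤ 5 1 t 6≤n
    avoid = edgesAvoidable-iso (complement G) (pathGraph 5 ⊕ t) iso (edgesAvoidable-⊕ (pathGraph 5) (inj₂ 1≤t))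
    F = image (↔-sym f) (inner ++ ⊥)
    ∣F∣≡2 : ∣ F ∣ ≡ 2
    ∣F∣≡2 = trans (∣image∣ (↔-sym f) (inner ++ ⊥)) (cong (2 +_) (∣⊥∣≡0 t))
    ∈F⇔ : ∀ v → v ∈ F ⇔ BasisForced G v
    ∈F⇔ v = mk⇔
      (⇐ (basisForced⇔forced G avoid v) ∘ ⇐ (forced-iso (complement G) (pathGraph 5 ⊕ t) iso v)
        ∘ ⇐ (path-forced 1≤t _) ∘ ∈-image⁻ (↔-sym f))
      (∈-image⁺ (↔-sym f) ∘ ⇒ (path-forced 1≤t _)
        ∘ ⇒ (forced-iso (complement G) (pathGraph 5 ⊕ t) iso v) ∘ ⇒ (basisForced⇔forced G avoid v))

  4≤numEdges-complement : ∃ (BasisForced G) → 4 ≤ numEdges (complement G)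
  4≤numEdges-complement (v , forced) = ℕ.≰⇒> λ e≤3 → few (embed unforcedEdges? (complement G) (fewEdges-unforced e≤3))
    where
    few : ¬ ∃ λ w → ∃ λ (es : EdgeList w) → Unforced (fromEdges es) × Embedding (fromEdges es) (complement G)
    few (_ , _ , unforced , emb) = unforced⇒¬basisForced unforced emb v forced

  fourEdges⇒path : ∃ (BasisForced G) → numEdges (complement G) ≡ 4 → Embedding (pathGraph 5) (complement G)
  fourEdges⇒path (v , forced) e≡4 = four (embed pathOrUnforced? (complement G) (fourEdges-path⊎unforced e≡4))
    where
    four : (∃ λ w → ∃ λ (es : EdgeList w) → (IsPath₅ (fromEdges es) ⊎ Unforced (fromEdges es))
      × Embedding (fromEdges es) (complement G)) → Embedding (pathGraph 5) (complement G)
    four (_ , _ , inj₁ path , emb)     = path-embedding path emb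
    four (_ , _ , inj₂ unforced , emb) = contradiction forced (unforced⇒¬basisForced unforced emb v)

theorem7 : (n : ℕ) → 6 ≤ n → (G : Graph n) → Connected G → ∃ (BasisForced G) →
    (numEdges G ≤ n * (n ∸ 1) / 2 ∸ 4)
    × (numEdges G ≡ n * (n ∸ 1) / 2 ∸ 4 →
    Isomorphic (complement G) (disjointUnion (pathGraph 5) (edgeless (n ∸ 5)))
    × ∃ λ (F : Subset n) → ∣ F ∣ ≡ 2 × (∀ v → v ∈ F ⇔ BasisForced G v))
theorem7 n 6≤n G _ forced rewrite sym (numEdges-complement G) =
  -- The number of all pairs is now `e + e′`, so the bound amounts to `4 ≤ e′`.
  ℕ.m+n≤o⇒m≤o∸n e (ℕ.+-monoʳ-≤ e 4≤e′)
  -- Since 4 is at most `e + e′`, the truncated subtraction is exact, and equality gives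
  -- `e + e′ ≡ e + 4`.
  , λ e≡ → path⇒basisForced G 6≤n (fourEdges⇒path G 6≤n forced (ℕ.+-cancelˡ-≡ e e′ 4 (
      sym (trans (cong (_+ 4) e≡) (ℕ.m∸n+n≡m (ℕ.≤-trans 4≤e′ (ℕ.m≤n+m e′ e)))))))
  where
  e = numEdges G
  e′ = numEdges (complement G)
  4≤e′ = 4≤numEdges-complement G 6≤n forced
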